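{- For all integers $k \geq 0$ and $n \geq 0$, the set of all planar rooted forests with $k+1$ trees and $n$ edges (in total) contains exactly $C^k_n$ elements.
   Context: Catalan numbers: $C_0 = 1$ and $C_{n+1} = \sum_{i=0}^n C_i C_{n-i}$ for $n \geq 0$. Self-convolutions: the convolution of two sequences $A = (A_n)_{n\ge 0}$ and $B = (B_n)_{n \ge 0}$ is $(A \ast B)_n = \sum_{m=0}^n A_m B_{n-m}$. For $k \geq 0$, $C^k$ denotes the sequence $C \ast \cdots \ast C$ with $k+1$ factors, where $C = (C_n)_{n\ge0}$; in particular $C^0 = C$ and $C^1 = C \ast C$. Its $n$th term is denoted $C^k_n$. Planar rooted forests: a rooted tree is a (finite) tree with a specified vertex called the root; a single vertex with no edges is allowed. A planar rooted tree is a rooted tree in which the children of each vertex carry a left-to-right linear order, and planar rooted trees are considered up to isomorphism preserving the root and these orders. A planar rooted forest with $k+1$ trees is a collection of $k+1$ planar rooted trees given in a specified order, i.e. an ordered $(k+1)$-tuple of planar rooted trees (repetitions allowed; the order of the trees matters). Its number of edges is the total number of edges of its trees. -}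

module Defs where

open import Data.List.Base using (List; []; _∷_; applyUpTo)
open import Data.Nat.Base using (ℕ; zero; suc; _+_; _*_; _∸_; _≤_; _<_; z≤n; s≤s)
open import Data.Nat.ListAction using (sum)
open import Data.Nat.Properties using (m∸n≤m; ≤-refl; ≤-trans)
open import Data.Product.Base using (Σ-syntax)
open import Data.Vec.Base as Vec using (Vec)
open import Function.Base using (_∘_)
open import Relation.Binary.PropositionalEquality using (_≡_; refl; cong₂)

Sequence : Set
Sequence = ℕ → ℕ

infixl 7 _⋆_

-- (A ⋆ B) n = A 0 * B n + A 1 * B (n ∸ 1) + ⋯ + A n * B 0
_⋆_ : Sequence → Sequence → Sequence
(A ⋆ B) n = sum (applyUpTo (λ m → A m * B (n ∸ m)) (suc n))

-- A ⋆ ⋯ ⋆ A with k + 1 (not k) factors.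
selfConvolution : Sequence → ℕ → Sequence
selfConvolution A zero    = A
selfConvolution A (suc k) = A ⋆ selfConvolution A k

-- The recurrence C₀ = 1, Cₙ₊₁ = (C ⋆ C)ₙ is not structurally recursive, so it
-- is unfolded to a bounded depth; depth d already gives the correct values at
-- all indices n ≤ d.  The recurrence itself is catalan-zero and catalan-suc.
catalanUpTo : ℕ → Sequence
catalanUpTo d       zero    = 1
catalanUpTo zero    (suc n) = 0
catalanUpTo (suc d) (suc n) = (catalanUpTo d ⋆ catalanUpTo d) n

catalan : Sequence
catalan n = catalanUpTo n n

private
  sum-cong : ∀ {f g : ℕ → ℕ} n → (∀ m → m < n → f m ≡ g m) →
             sum (applyUpTo f n) ≡ sum (applyUpTo g n)
  sum-cong zero    eq = refl
  sum-cong (suc n) eq =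
    cong₂ _+_ (eq 0 (s≤s z≤n)) (sum-cong n (λ m m<n → eq (suc m) (s≤s m<n)))

  ⋆-cong : ∀ {A A′ B B′ : Sequence} n →
           (∀ m → m ≤ n → A m ≡ A′ m) → (∀ m → m ≤ n → B m ≡ B′ m) →
           (A ⋆ B) n ≡ (A′ ⋆ B′) n
  ⋆-cong n p q = sum-cong (suc n) λ where
    m (s≤s m≤n) → cong₂ _*_ (p m m≤n) (q (n ∸ m) (m∸n≤m n m))

  catalanUpTo-stable : ∀ {d e} n → n ≤ d → n ≤ e → catalanUpTo d n ≡ catalanUpTo e n
  catalanUpTo-stable zero    _         _         = refl
  catalanUpTo-stable (suc n) (s≤s n≤d) (s≤s n≤e) = ⋆-cong n stable stable
    where
    stable = λ m m≤n → catalanUpTo-stable m (≤-trans m≤n n≤d) (≤-trans m≤n n≤e)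

catalan-zero : catalan 0 ≡ 1
catalan-zero = refl

catalan-suc : ∀ n → catalan (suc n) ≡ (catalan ⋆ catalan) n
catalan-suc n = ⋆-cong n stable stable
  where
  stable = λ m m≤n → catalanUpTo-stable m m≤n ≤-refl

-- A root together with the left-to-right list of the planar rooted trees
-- hanging from its children; vertices are unnamed, so _≡_ is isomorphism of
-- planar rooted trees.
data PlanarRootedTree : Set where
  node : List PlanarRootedTree → PlanarRootedTree

-- Each child of the root contributes the edge joining it to the root and the
-- edges of the subtree below it.
mutual
  edges : PlanarRootedTree → ℕ
  edges (node ts) = edgesBelow ts

  edgesBelow : List PlanarRootedTree → ℕ
  edgesBelow []       = 0
  edgesBelow (t ∷ ts) = suc (edges t) + edgesBelow ts

PlanarRootedForest : ℕ → Set
PlanarRootedForest = Vec PlanarRootedTree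

forestEdges : ∀ {r} → PlanarRootedForest r → ℕ
forestEdges = Vec.sum ∘ Vec.map edges

-- Equality proofs in ℕ are unique, so elements of this type correspond to
-- forests with r trees and n edges, each occurring exactly once.
ForestWithEdges : ℕ → ℕ → Set
ForestWithEdges r n = Σ[ f ∈ PlanarRootedForest r ] forestEdges f ≡ n

{-# OPTIONS --safe #-}

-- Splitting off the leftmost child of the root turns a tree with n + 1 edges
-- into a pair of trees with n edges in total, so planar rooted trees are counted
-- by the Catalan recurrence.  A forest is its first tree together with the
-- remaining ones, so each further tree convolves the count with C once more.
module Submission where

open import Defs
open import Data.Fin.Base as Fin using (Fin; toℕ; fromℕ<)
open import Data.Fin.Properties
  using (+↔⊎; *↔×; toℕ<n; toℕ-fromℕ<; toℕ-injective)
open import Data.List.Base using ([]; _∷_; applyUpTo)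
open import Data.Nat.Base using (ℕ; zero; suc; _+_; _*_; _∸_; _≤_; _<_; s≤s; s≤s⁻¹)
open import Data.Nat.ListAction using (sum)
open import Data.Nat.Properties
  using (≡-irrelevant; ≤-refl; ≤-trans; m≤m+n; m∸n≤m; m+n∸m≡n; m+[n∸m]≡n; +-identityʳ; suc-injective)
open import Data.Product.Base using (Σ; Σ-syntax; _×_; _,_)
open import Data.Product.Function.NonDependent.Propositional using (_×-↔_)
open import Data.Sum.Base using (_⊎_; inj₁; inj₂)
open import Data.Sum.Function.Propositional using (_⊎-↔_)
open import Data.Vec.Base using ([]; _∷_)
open import Function.Base using (_∘_)
open import Function.Bundles using (_↔_; Inverse; mk↔ₛ′)
open import Function.Construct.Composition using (_↔-∘_)
open import Function.Construct.Symmetry using (↔-sym)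
open import Relation.Binary.PropositionalEquality
  using (_≡_; refl; sym; trans; cong; cong₂; subst; _≗_)

-- `ForestWithEdges r n` unfolds to `Fiber forestEdges n`, so trees and forests share the same
-- lemmas.
Fiber : {X : Set} → (X → ℕ) → ℕ → Set
Fiber {X} f n = Σ[ x ∈ X ] f x ≡ n

-- Stated at one index at a time, because `catalanUpTo d` has the right values only at indices up to
-- `d`.
Counts : {X : Set} → (X → ℕ) → Sequence → ℕ → Set
Counts f A n = Fiber f n ↔ Fin (A n)

Fiber-≡ : ∀ {X : Set} {f : X → ℕ} {n} {x y : X} {p : f x ≡ n} {q : f y ≡ n} →
          x ≡ y → _≡_ {A = Fiber f n} (x , p) (y , q)
Fiber-≡ {x = x} {p = p} {q} refl = cong (x ,_) (≡-irrelevant p q)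

Fiber-cong : ∀ {X Y : Set} {f : X → ℕ} {g : Y → ℕ} (e : X ↔ Y) →
             f ≗ g ∘ Inverse.to e → ∀ n → Fiber f n ↔ Fiber g n
Fiber-cong {f = f} {g} e f≗g n = mk↔ₛ′
  (λ (x , p) → to x , trans (sym (f≗g x)) p)
  (λ (y , q) → from y , trans (f≗g (from y)) (trans (cong g (strictlyInverseˡ y)) q))
  (λ (y , _) → Fiber-≡ (strictlyInverseˡ y))
  (λ (x , _) → Fiber-≡ (strictlyInverseʳ x))
  where open Inverse e

Σ-Fin-suc↔⊎ : ∀ {n} {P : Fin (suc n) → Set} →
              Σ (Fin (suc n)) P ↔ (P Fin.zero ⊎ Σ (Fin n) (P ∘ Fin.suc))
Σ-Fin-suc↔⊎ = mk↔ₛ′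
  (λ { (Fin.zero , p) → inj₁ p ; (Fin.suc i , p) → inj₂ (i , p) })
  (λ { (inj₁ p) → Fin.zero , p ; (inj₂ (i , p)) → Fin.suc i , p })
  (λ { (inj₁ _) → refl ; (inj₂ _) → refl })
  (λ { (Fin.zero , _) → refl ; (Fin.suc _ , _) → refl })

-- With `f` defined on all of `ℕ`, peeling off index zero replaces `f` by `f ∘ suc`, exactly as
-- `applyUpTo` does.
Σ-Fin↔sum : ∀ n {P : Fin n → Set} (f : ℕ → ℕ) → (∀ i → P i ↔ Fin (f (toℕ i))) →
            Σ (Fin n) P ↔ Fin (sum (applyUpTo f n))
Σ-Fin↔sum zero    f e = mk↔ₛ′ (λ ()) (λ ()) (λ ()) (λ ())
Σ-Fin↔sum (suc n) f e =
  ↔-sym +↔⊎ ↔-∘ ((e Fin.zero ⊎-↔ Σ-Fin↔sum n (f ∘ suc) (e ∘ Fin.suc)) ↔-∘ Σ-Fin-suc↔⊎)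

infixl 6 _⊞_

_⊞_ : ∀ {X Y : Set} → (X → ℕ) → (Y → ℕ) → X × Y → ℕ
(f ⊞ g) (x , y) = f x + g y

module _ {X Y : Set} {f : X → ℕ} {g : Y → ℕ} where

  Split : ℕ → Set
  Split n = Σ[ i ∈ Fin (suc n) ] Fiber f (toℕ i) × Fiber g (n ∸ toℕ i)

  Split-≡ : ∀ {n} {i j : Fin (suc n)} {x y p q p′ q′} → i ≡ j →
            _≡_ {A = Split n} (i , (x , p) , (y , q)) (j , (x , p′) , (y , q′))
  Split-≡ {i = i} refl = cong (i ,_) (cong₂ _,_ (Fiber-≡ refl) (Fiber-≡ refl))

  -- The index in `Split n` is forced to be `f x`; recording it exposes the pairs as a disjoint
  -- union over the terms of a convolution.
  Fiber-⊞↔Split : ∀ n → Fiber (f ⊞ g) n ↔ Split n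
  Fiber-⊞↔Split n = mk↔ₛ′ to from to∘from (λ _ → Fiber-≡ refl)
    where
    fx<1+n : ∀ {x y} → f x + g y ≡ n → f x < suc n
    fx<1+n {x} {y} p = s≤s (subst (f x ≤_) p (m≤m+n (f x) (g y)))

    to : Fiber (f ⊞ g) n → Split n
    to ((x , y) , p) =
      fromℕ< (fx<1+n p) , (x , sym i≡fx) ,
      (y , trans (sym (m+n∸m≡n (f x) (g y))) (cong₂ _∸_ p (sym i≡fx)))
      where i≡fx = toℕ-fromℕ< (fx<1+n p)

    from : Split n → Fiber (f ⊞ g) n
    from (i , (x , p) , (y , q)) =
      (x , y) , trans (cong₂ _+_ p q) (m+[n∸m]≡n (s≤s⁻¹ (toℕ<n i)))

    to∘from : ∀ s → to (from s) ≡ s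
    to∘from (i , (x , p) , (y , q)) =
      -- The index rebuilt by `to` has value `f x`, and `p` equates this with the value of `i`.
      Split-≡ (toℕ-injective (trans (toℕ-fromℕ< _) p))

  Counts-⊞ : ∀ {A B : Sequence} n →
             (∀ m → m ≤ n → Counts f A m) → (∀ m → m ≤ n → Counts g B m) →
             Counts (f ⊞ g) (A ⋆ B) n
  Counts-⊞ {A} {B} n countsA countsB =
    Σ-Fin↔sum (suc n) (λ m → A m * B (n ∸ m)) (λ i →
      ↔-sym *↔× ↔-∘ (countsA (toℕ i) (s≤s⁻¹ (toℕ<n i)) ×-↔ countsB (n ∸ toℕ i) (m∸n≤m n (toℕ i))))
    ↔-∘ Fiber-⊞↔Split n

edges-zero : Fiber edges 0 ↔ Fin 1
edges-zero = mk↔ₛ′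
  (λ _ → Fin.zero)
  (λ _ → node [] , refl)
  (λ { Fin.zero → refl ; (Fin.suc ()) })
  (λ { (node [] , refl) → refl })

-- The other children stay on the root, giving `node ts`. The cut edge is the `suc` in `edgesBelow`,
-- so both edge counts agree by computation.
edges-suc : ∀ n → Fiber edges (suc n) ↔ Fiber (edges ⊞ edges) n
edges-suc n = mk↔ₛ′
  (λ { (node (t ∷ ts) , p) → (t , node ts) , suc-injective p })
  (λ { ((t , node ts) , p) → node (t ∷ ts) , cong suc p })
  (λ { ((t , node ts) , p) → Fiber-≡ refl })
  (λ { (node (t ∷ ts) , p) → Fiber-≡ refl })

-- Both trees of a split may have any size up to `n`, so the recursion is on the depth `d`: at
-- `suc d` the count unfolds to the convolution of `catalanUpTo d` with itself.
treesUpTo : ∀ d n → n ≤ d → Counts edges (catalanUpTo d) n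
treesUpTo d       zero    _         = edges-zero
treesUpTo (suc d) (suc n) (s≤s n≤d) = Counts-⊞ n trees trees ↔-∘ edges-suc n
  where
  trees : ∀ m → m ≤ n → Counts edges (catalanUpTo d) m
  trees m m≤n = treesUpTo d m (≤-trans m≤n n≤d)

singletonForest : PlanarRootedForest 1 ↔ PlanarRootedTree
singletonForest = mk↔ₛ′
  (λ { (t ∷ []) → t }) (λ t → t ∷ []) (λ _ → refl) (λ { (_ ∷ []) → refl })

unconsForest : ∀ {r} → PlanarRootedForest (suc r) ↔ (PlanarRootedTree × PlanarRootedForest r)
unconsForest = mk↔ₛ′
  (λ { (t ∷ ts) → t , ts }) (λ (t , ts) → t ∷ ts) (λ _ → refl) (λ { (_ ∷ _) → refl })

theorem4p7 : (k n : ℕ) → ForestWithEdges (suc k) n ↔ Fin (selfConvolution catalan k n)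
theorem4p7 zero    n =
  -- The sum over a one-entry vector ends in `+ 0`, hence `+-identityʳ`.
  treesUpTo n n ≤-refl ↔-∘ Fiber-cong singletonForest (λ { (t ∷ []) → +-identityʳ (edges t) }) n
theorem4p7 (suc k) n =
  -- The depth is chosen anew for each `m`, since `catalan m` is `catalanUpTo m m`.
  Counts-⊞ n (λ m _ → treesUpTo m m ≤-refl) (λ m _ → theorem4p7 k m)
  ↔-∘ Fiber-cong unconsForest (λ { (_ ∷ _) → refl }) n
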